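{- Let $G=K_m+\overline{K_n}$ be the complete split graph, i.e. the join of the complete graph $K_m$ and the edgeless graph $\overline{K_n}$ on $n$ vertices, with $n\ge 2$. Then $\operatorname{nim}(\mathrm{DNT}(G))=\operatorname{pty}(m)$ and $\operatorname{nim}(\mathrm{TER}(G))=1+\operatorname{pty}(m)$.
   Context: Graphs are finite and simple with nonempty vertex set. The join of two graphs is their disjoint union together with all edges between the two vertex sets. For a graph $G$ with vertex set $V$, a set $K\subseteq V$ is convex if it contains every vertex lying on any shortest path between two elements of $K$. The convex hull $[P]$ of $P\subseteq V$ is the smallest convex set containing $P$. For an integer $k$, $\operatorname{pty}(k):=k\bmod 2\in\{0,1\}$. The game $\mathrm{DNT}(G)$: positions are the sets $P\subseteq V$ with $[V\setminus P]=V$; the starting position is $\emptyset$; the options of $P$ are the sets $P\cup\{v\}$ with $v\in V\setminus P$ and $[V\setminus(P\cup\{v\})]=V$. The game $\mathrm{TER}(G)$: positions are the sets $P\subseteq V$ reachable from the starting position $\emptyset$ by the following moves. If $[V\setminus P]=V$, then the options of $P$ are all sets $P\cup\{v\}$ with $v\in V\setminus P$; if $[V\setminus P]\neq V$, then $P$ is terminal (has no options). The nim-value of a position is defined recursively by $\operatorname{nim}(p)=\operatorname{mex}\{\operatorname{nim}(q): q\text{ an option of }p\}$, where $\operatorname{mex}(A)$ is the smallest nonnegative integer not in $A$; the nim-value of a game is that of its starting position. -}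

module Defs where

open import Data.Bool.Properties using () renaming (_≟_ to _≟ᵇ_)
open import Data.Fin using (Fin; toℕ; fromℕ<; splitAt; zero; suc)
open import Data.Fin.Properties using (_≟_; any?; all?; injective⇒≤; toℕ<n; toℕ-fromℕ<; toℕ-inject; toℕ-injective; ¬∀⟶∃¬-smallest)
open import Data.Fin.Subset using (Subset; _∈_; _∉_; _⊆_; _⊃_; ⊤; ⊥; ∁; _∪_; ⁅_⁆)
open import Data.Fin.Subset.Induction using (⊃-wellFounded)
open import Data.Fin.Subset.Properties using (_∈?_; _⊆?_; anySubset?; ⊆⊤; ⊆-antisym; x∉p⇒x∈∁p; ∉⊥; p⊆p∪q; q⊆p∪q; x∈⁅x⁆)
open import Data.Integer using (ℤ)
open import Data.Integer.DivMod using (_%ℕ_)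
open import Data.List using (List; []; _∷_; length; map; filter; mapMaybe; allFin; lookup)
import Data.List.Membership.DecPropositional as DecMembership
open import Data.List.Membership.Propositional using (mapWith∈) renaming (_∈_ to _∈ˡ_; _∉_ to _∉ˡ_)
open import Data.List.Membership.Propositional.Properties using (∈-map⁻; ∈-filter⁻; ∈-lookup; mapWith∈-cong; mapWith∈≗map)
open import Data.List.Membership.Setoid.Properties using (index-injective)
open import Data.List.Relation.Unary.All as All using ()
open import Data.List.Relation.Unary.AllPairs using (_∷_)
open import Data.List.Relation.Unary.Any using (here; there; index)
open import Data.List.Relation.Unary.Any.Properties using (mapWith∈⁻)
import Data.List.Relation.Unary.Unique.DecPropositional as DecUnique
open import Data.List.Relation.Unary.Unique.Propositional using (Unique)
open import Data.Maybe as Maybe using (Maybe)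
open import Data.Nat using (ℕ; zero; suc; _+_; _≤_; _<_)
import Data.Nat.Properties as ℕ
open import Data.Product using (∃; _×_; _,_; proj₁; proj₂; ∃-syntax; Σ-syntax)
open import Data.Sum using (_⊎_; inj₁; inj₂)
open import Data.Unit using () renaming (⊤ to 𝟙; tt to tt)
open import Data.Vec using (tabulate)
open import Data.Vec.Properties using (≡-dec; lookup∘tabulate; []=⇒lookup; lookup⇒[]=)
open import Function using (_∘_)
open import Induction.WellFounded using (WellFounded; Acc; acc; module Subrelation)
open import Level using (0ℓ)
open import Relation.Binary using (Rel; Decidable; Symmetric; Irreflexive)
open import Relation.Binary.Construct.Closure.ReflexiveTransitive using (Star; ε; _◅_)
import Relation.Binary.Construct.On as On
open import Relation.Binary.PropositionalEquality using (_≡_; _≢_; refl; sym; trans; cong; subst; setoid; ≢-sym)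
open import Relation.Nullary using (¬_; Dec; yes; no; does; contradiction)
open import Relation.Nullary.Decidable using (map′; ¬?; _×-dec_; _→-dec_; dec⇒maybe; dec-true; dec-false; decidable-stable)
open import Relation.Unary using (Pred) renaming (Decidable to Decidable₁)

pty : ℤ → ℕ
pty k = k %ℕ 2

-- A graph may be empty; results about nonempty graphs must ensure this separately.
record Graph : Set₁ where
  field
    order  : ℕ
  Vertex : Set
  Vertex = Fin order
  infix 4 _~_
  field
    _~_    : Rel Vertex 0ℓ
    _~?_   : Decidable _~_
    ~-sym  : Symmetric _~_
    ~-irr  : Irreflexive _≡_ _~_

K : ℕ → Graph
K n = record
  { order = n
  ; _~_   = _≢_
  ; _~?_  = λ u v → ¬? (u ≟ v)
  ; ~-sym = ≢-sym
  ; ~-irr = λ u≡v u≢v → u≢v u≡v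
  }

complement : Graph → Graph
complement G = record
  { order = order
  ; _~_   = λ u v → u ≢ v × ¬ (u ~ v)
  ; _~?_  = λ u v → ¬? (u ≟ v) ×-dec ¬? (u ~? v)
  ; ~-sym = λ (u≢v , u≁v) → ≢-sym u≢v , u≁v ∘ ~-sym
  ; ~-irr = λ u≡v (u≢v , _) → u≢v u≡v
  }
  where open Graph G

module _ (G H : Graph) where
  private
    module G = Graph G
    module H = Graph H

  JoinAdj : Rel (G.Vertex ⊎ H.Vertex) 0ℓ
  JoinAdj (inj₁ u) (inj₁ v) = u G.~ v
  JoinAdj (inj₁ _) (inj₂ _) = 𝟙
  JoinAdj (inj₂ _) (inj₁ _) = 𝟙
  JoinAdj (inj₂ u) (inj₂ v) = u H.~ v

  private
    joinAdj? : Decidable JoinAdj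
    joinAdj? (inj₁ u) (inj₁ v) = u G.~? v
    joinAdj? (inj₁ _) (inj₂ _) = yes tt
    joinAdj? (inj₂ _) (inj₁ _) = yes tt
    joinAdj? (inj₂ u) (inj₂ v) = u H.~? v

    joinAdj-sym : Symmetric JoinAdj
    joinAdj-sym {inj₁ _} {inj₁ _} = G.~-sym
    joinAdj-sym {inj₁ _} {inj₂ _} = λ _ → tt
    joinAdj-sym {inj₂ _} {inj₁ _} = λ _ → tt
    joinAdj-sym {inj₂ _} {inj₂ _} = H.~-sym

    joinAdj-irr : ∀ x → ¬ JoinAdj x x
    joinAdj-irr (inj₁ _) = G.~-irr refl
    joinAdj-irr (inj₂ _) = H.~-irr refl

  -- The vertices of G come first, followed by those of H.
  join : Graph
  join = record
    { order = G.order + H.order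
    ; _~_   = λ u v → JoinAdj (splitAt G.order u) (splitAt G.order v)
    ; _~?_  = λ u v → joinAdj? (splitAt G.order u) (splitAt G.order v)
    ; ~-sym = λ {u} {v} → joinAdj-sym {splitAt G.order u} {splitAt G.order v}
    ; ~-irr = λ { {u} refl → joinAdj-irr (splitAt G.order u) }
    }

module _ (G : Graph) where
  open Graph G

  Walk : Rel Vertex 0ℓ
  Walk = Star _~_

  edges : ∀ {u v} → Walk u v → ℕ
  edges ε       = 0
  edges (_ ◅ w) = suc (edges w)

  vertices : ∀ {u v} → Walk u v → List Vertex
  vertices {u} ε       = u ∷ []
  vertices {u} (_ ◅ w) = u ∷ vertices w

  IsPath : ∀ {u v} → Walk u v → Set
  IsPath w = Unique (vertices w)

  IsShortestPath : ∀ {u v} → Walk u v → Set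
  IsShortestPath {u} {v} w =
    IsPath w × (∀ (w′ : Walk u v) → IsPath w′ → edges w ≤ edges w′)

  OnShortestPath : Vertex → Vertex → Vertex → Set
  OnShortestPath u v x =
    Σ[ w ∈ Walk u v ] IsShortestPath w × x ∈ˡ vertices w

  IsConvex : Pred (Subset order) 0ℓ
  IsConvex C = ∀ u v x → u ∈ C → v ∈ C → OnShortestPath u v x → x ∈ C

  IsConvexHull : Subset order → Pred (Subset order) 0ℓ
  IsConvexHull P H =
    IsConvex H × P ⊆ H × (∀ C → IsConvex C → P ⊆ C → H ⊆ C)

  private
    -- A path has fewer edges than there are vertices, so deciding convexity
    -- takes a search over walks of bounded length only.
    lookup-injective : ∀ {xs : List Vertex} → Unique xs →
                       ∀ {i j} → lookup xs i ≡ lookup xs j → i ≡ j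
    lookup-injective (_    ∷ _)  {zero}  {zero}  _  = refl
    lookup-injective (x≢xs ∷ _)  {zero}  {suc j} eq = contradiction eq (All.lookup x≢xs (∈-lookup j))
    lookup-injective (x≢xs ∷ _)  {suc i} {zero}  eq = contradiction (sym eq) (All.lookup x≢xs (∈-lookup i))
    lookup-injective (_    ∷ xs) {suc i} {suc j} eq = cong suc (lookup-injective xs eq)

    length-vertices : ∀ {u v} (w : Walk u v) → length (vertices w) ≡ suc (edges w)
    length-vertices ε       = refl
    length-vertices (_ ◅ w) = cong suc (length-vertices w)

    path-bound : ∀ {u v} (w : Walk u v) → IsPath w → edges w < order
    path-bound w p =
      subst (_≤ order) (length-vertices w) (injective⇒≤ (lookup-injective p))

    walk? : ∀ {Q : Pred (List Vertex) 0ℓ} → Decidable₁ Q → ∀ k u v →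
            Dec (Σ[ w ∈ Walk u v ] edges w ≡ k × Q (vertices w))
    walk? Q? zero u v with u ≟ v
    ... | no u≢v = no λ { (ε , _) → u≢v refl }
    ... | yes refl =
      map′ (λ q → ε , refl , q) (λ { (ε , _ , q) → q }) (Q? (u ∷ []))
    walk? Q? (suc k) u v =
      map′ (λ { (_ , e , w , refl , q) → e ◅ w , refl , q })
           (λ { (e ◅ w , eq , q) → _ , e , w , ℕ.suc-injective eq , q })
           (any? λ x → (u ~? x) ×-dec walk? (Q? ∘ (u ∷_)) k x v)

    unique? : Decidable₁ (Unique {A = Vertex})
    unique? = DecUnique.unique? _≟_

    open DecMembership (_≟_ {order}) using () renaming (_∈?_ to _∈ˡ?_)

  onShortestPath? : ∀ u v → Decidable₁ (OnShortestPath u v)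
  onShortestPath? u v x = map′ (to ∘ proj₂) from (any? λ k →
      walk? (λ xs → unique? xs ×-dec (x ∈ˡ? xs)) (toℕ k) u v
      ×-dec all? λ (j : Fin (toℕ k)) → ¬? (walk? unique? (toℕ j) u v))
    where
    Shortest : ℕ → Set
    Shortest k =
      (Σ[ w ∈ Walk u v ] edges w ≡ k × Unique (vertices w) × x ∈ˡ vertices w) ×
      (∀ (j : Fin k) → ¬ (Σ[ w ∈ Walk u v ] edges w ≡ toℕ j × Unique (vertices w)))

    to : ∀ {k} → Shortest k → OnShortestPath u v x
    to ((w , refl , p , x∈w) , min) = w , (p , shortest) , x∈w
      where
      shortest : ∀ w′ → IsPath w′ → edges w ≤ edges w′
      shortest w′ p′ = ℕ.≮⇒≥ λ lt →
        min (fromℕ< lt) (w′ , sym (toℕ-fromℕ< lt) , p′)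

    from : OnShortestPath u v x → ∃ (λ (k : Fin order) → Shortest (toℕ k))
    from (w , (p , min) , x∈w) = fromℕ< (path-bound w p) ,
      subst Shortest (sym (toℕ-fromℕ< _))
        ( (w , refl , p , x∈w)
        , λ j (w′ , eq , p′) → ℕ.<⇒≱ (toℕ<n j) (subst (edges w ≤_) eq (min w′ p′)))

  isConvex? : Decidable₁ IsConvex
  isConvex? C = all? λ u → all? λ v → all? λ x →
    (u ∈? C) →-dec (v ∈? C) →-dec onShortestPath? u v x →-dec (x ∈? C)

  -- Opaque, since unfolding the search makes type checking very slow.
  opaque
    convexHull : ∀ P → ∃ (IsConvexHull P)
    convexHull P = H , convex , P⊆H , minimal
      where
      In : Pred Vertex 0ℓ
      In x = ∀ C → IsConvex C → P ⊆ C → x ∈ C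

      Avoided : Pred Vertex 0ℓ
      Avoided x = ∃[ C ] IsConvex C × P ⊆ C × x ∉ C

      avoided? : Decidable₁ Avoided
      avoided? x = anySubset? λ C → isConvex? C ×-dec (P ⊆? C) ×-dec ¬? (x ∈? C)

      ¬avoided⇒in : ∀ {x} → ¬ Avoided x → In x
      ¬avoided⇒in {x} ¬a C c P⊆C = decidable-stable (x ∈? C) λ x∉C → ¬a (C , c , P⊆C , x∉C)

      in⇒¬avoided : ∀ {x} → In x → ¬ Avoided x
      in⇒¬avoided i (C , c , P⊆C , x∉C) = x∉C (i C c P⊆C)

      in? : Decidable₁ In
      in? x = map′ ¬avoided⇒in in⇒¬avoided (¬? (avoided? x))

      H : Subset order
      H = tabulate (does ∘ in?)

      H⁻ : ∀ {x} → x ∈ H → In x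
      H⁻ {x} x∈H = decidable-stable (in? x) λ ¬i → contradiction
        (trans (sym (dec-false (in? x) ¬i)) (trans (sym (lookup∘tabulate (does ∘ in?) x)) ([]=⇒lookup x∈H)))
        λ ()

      H⁺ : ∀ {x} → In x → x ∈ H
      H⁺ {x} i = lookup⇒[]= x H (trans (lookup∘tabulate (does ∘ in?) x) (dec-true (in? x) i))

      convex : IsConvex H
      convex u v x u∈H v∈H s =
        H⁺ λ C c P⊆C → c u v x (H⁻ u∈H C c P⊆C) (H⁻ v∈H C c P⊆C) s

      P⊆H : P ⊆ H
      P⊆H x∈P = H⁺ λ C c P⊆C → P⊆C x∈P

      minimal : ∀ C → IsConvex C → P ⊆ C → H ⊆ C
      minimal C c P⊆C x∈H = H⁻ x∈H C c P⊆C

  hull : Subset order → Subset order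
  hull P = proj₁ (convexHull P)

IsMex : List ℕ → Pred ℕ 0ℓ
IsMex A k = k ∉ˡ A × (∀ j → j < k → j ∈ˡ A)

private
  mexExists : ∀ A → ∃ (IsMex A)
  mexExists A with ¬∀⟶∃¬-smallest (suc (length A)) (λ i → toℕ i ∈ˡ A) (λ i → toℕ i ∈ℕ? A) ¬all
    where
    open DecMembership ℕ._≟_ using () renaming (_∈?_ to _∈ℕ?_)
    ¬all : ¬ (∀ (i : Fin (suc (length A))) → toℕ i ∈ˡ A)
    ¬all all∈ = ℕ.<-irrefl refl (injective⇒≤ {f = index ∘ all∈} λ {i} {j} eq →
      toℕ-injective (index-injective (setoid ℕ) (all∈ i) (all∈ j) eq))
  ... | i , i∉A , below = toℕ i , i∉A , λ j j<i →
    subst (_∈ˡ A) (trans (toℕ-inject (fromℕ< j<i)) (toℕ-fromℕ< j<i)) (below (fromℕ< j<i))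

mex : List ℕ → ℕ
mex A = proj₁ (mexExists A)

mex-isMex : ∀ A → IsMex A (mex A)
mex-isMex A = proj₂ (mexExists A)

record Game : Set₁ where
  field
    Position : Set
    start    : Position
    options  : Position → List Position

  _IsOptionOf_ : Rel Position 0ℓ
  q IsOptionOf p = q ∈ˡ options p

  field
    wellFounded : WellFounded _IsOptionOf_

module _ (Γ : Game) where
  open Game Γ

  private
    nimAcc : ∀ p → Acc _IsOptionOf_ p → ℕ
    nimAcc p (acc rs) = mex (mapWith∈ (options p) λ {q} q∈ → nimAcc q (rs q∈))

    nimAcc-irr : ∀ p (a b : Acc _IsOptionOf_ p) → nimAcc p a ≡ nimAcc p b
    nimAcc-irr p (acc rs) (acc rs′) = cong mex
      (mapWith∈-cong (options p) _ _ λ {q} q∈ → nimAcc-irr q (rs q∈) (rs′ q∈))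

  nimValue : Position → ℕ
  nimValue p = nimAcc p (wellFounded p)

  nimValue-mex : ∀ p → nimValue p ≡ mex (map nimValue (options p))
  nimValue-mex p with wellFounded p
  ... | acc rs = cong mex (trans
    (mapWith∈-cong (options p) _ _ λ {q} q∈ → nimAcc-irr q (rs q∈) (wellFounded q))
    (mapWith∈≗map nimValue (options p)))

  nim : ℕ
  nim = nimValue start

module _ (G : Graph) where
  open Graph G

  ComplementGenerates : Pred (Subset order) 0ℓ
  ComplementGenerates P = hull G (∁ P) ≡ ⊤

  complementGenerates? : Decidable₁ ComplementGenerates
  complementGenerates? P = ≡-dec _≟ᵇ_ (hull G (∁ P)) ⊤

  -- All sets P ∪ {v} with v ∉ P.
  extensions : Subset order → List (Subset order)
  extensions P = map (λ v → P ∪ ⁅ v ⁆) (filter (λ v → ¬? (v ∈? P)) (allFin order))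

  private
    extensions-⊃ : ∀ {P Q} → Q ∈ˡ extensions P → Q ⊃ P
    extensions-⊃ {P} Q∈ with ∈-map⁻ _ Q∈
    ... | v , v∈ , refl =
      p⊆p∪q ⁅ v ⁆ , v , q⊆p∪q P ⁅ v ⁆ (x∈⁅x⁆ v) ,
      proj₂ (∈-filter⁻ (λ v → ¬? (v ∈? P)) {xs = allFin order} v∈)

    ∅-complementGenerates : ComplementGenerates ⊥
    ∅-complementGenerates = ⊆-antisym ⊆⊤ λ _ →
      proj₁ (proj₂ (proj₂ (convexHull G (∁ ⊥)))) (x∉p⇒x∈∁p ∉⊥)

  DNTPosition : Set
  DNTPosition = Σ[ P ∈ Subset order ] ComplementGenerates P

  toDNTPosition : Subset order → Maybe DNTPosition
  toDNTPosition P = Maybe.map (P ,_) (dec⇒maybe (complementGenerates? P))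

  DNT : Game
  DNT = record
    { Position    = DNTPosition
    ; start       = ⊥ , ∅-complementGenerates
    ; options     = options
    ; wellFounded = Subrelation.wellFounded (λ {q} {p} → option⇒⊃ {q} {p}) (On.wellFounded proj₁ ⊃-wellFounded)
    }
    where
    options : DNTPosition → List DNTPosition
    options (P , _) = mapMaybe toDNTPosition (extensions P)

    mapMaybe-∈ : ∀ Qs {q} → q ∈ˡ mapMaybe toDNTPosition Qs → proj₁ q ∈ˡ Qs
    mapMaybe-∈ (Q ∷ Qs) q∈ with complementGenerates? Q
    mapMaybe-∈ (Q ∷ Qs) q∈          | no  _ = there (mapMaybe-∈ Qs q∈)
    mapMaybe-∈ (Q ∷ Qs) (here refl) | yes _ = here refl
    mapMaybe-∈ (Q ∷ Qs) (there q∈)  | yes _ = there (mapMaybe-∈ Qs q∈)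

    option⇒⊃ : ∀ {q p} → q ∈ˡ options p → proj₁ q ⊃ proj₁ p
    option⇒⊃ {_} {P , _} q∈ = extensions-⊃ (mapMaybe-∈ (extensions P) q∈)

  terMoves : Subset order → List (Subset order)
  terMoves P with complementGenerates? P
  ... | yes _ = extensions P
  ... | no  _ = []

  data Reachable : Subset order → Set where
    initial : Reachable ⊥
    move    : ∀ {P Q} → Reachable P → Q ∈ˡ terMoves P → Reachable Q

  TERPosition : Set
  TERPosition = Σ[ P ∈ Subset order ] Reachable P

  TER : Game
  TER = record
    { Position    = TERPosition
    ; start       = ⊥ , initial
    ; options     = options
    ; wellFounded = Subrelation.wellFounded (λ {q} {p} → option⇒⊃ {q} {p}) (On.wellFounded proj₁ ⊃-wellFounded)
    }
    where
    options : TERPosition → List TERPosition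
    options (P , r) = mapWith∈ (terMoves P) λ {Q} Q∈ → Q , move r Q∈

    terMoves-⊃ : ∀ {P Q} → Q ∈ˡ terMoves P → Q ⊃ P
    terMoves-⊃ {P} Q∈ with complementGenerates? P
    terMoves-⊃ Q∈ | yes _ = extensions-⊃ Q∈
    terMoves-⊃ () | no  _

    option⇒⊃ : ∀ {q p} → q ∈ˡ options p → proj₁ q ⊃ proj₁ p
    option⇒⊃ {_} {P , _} q∈ with mapWith∈⁻ (terMoves P) _ q∈
    ... | _ , Q∈ , refl = terMoves-⊃ Q∈

{-# OPTIONS --safe #-}
-- For n ≥ 2 a set P has a complement generating V exactly when P lies inside
-- the clique: a vertex outside the clique is simplicial, so its removal leaves
-- a convex set, whereas two vertices outside the clique are nonadjacent with
-- every clique vertex midway between them. So DNT consists of exactly m forced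
-- moves. In TER every nonterminal position also has a terminal option, of
-- nim-value 0, besides the clique moves; this shifts all values up by one.
module Submission where

open import Defs
open import Data.Bool using (true; false)
open import Data.Fin using (Fin; splitAt; zero; suc; _↑ʳ_)
open import Data.Fin.Properties using (_≟_; splitAt⁻¹-↑ˡ; splitAt-↑ʳ; ↑ʳ-injective; any?)
open import Data.Fin.Subset using (Subset; _∈_; _∉_; _⊆_; ⊤; ⊥; ∁; _∪_; ⁅_⁆; ∣_∣)
open import Data.Fin.Subset.Properties
  using (_∈?_; ⊆⊤; ⊆-antisym; ∈⊤; ⊥⊆; ∣⊥∣≡0; p⊆q⇒∣p∣≤∣q∣; p⊂q⇒∣p∣<∣q∣; x∈∁p⇒x∉p; x∉p⇒x∈∁p;
         x∈⁅x⁆; x∈⁅y⁆⇒x≡y; x∈p∪q⁻; x∈p∪q⁺; ∪-identityʳ)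
open import Data.Integer using (+_)
open import Data.List using (_∷_; []; map; mapMaybe; allFin)
open import Data.List.Membership.Propositional using () renaming (_∈_ to _∈ˡ_)
open import Data.List.Membership.Propositional.Properties
  using (∈-map⁺; ∈-map⁻; ∈-filter⁺; ∈-filter⁻; ∈-allFin)
open import Data.List.Relation.Binary.Subset.Propositional using () renaming (_⊆_ to _⊆ˡ_)
open import Data.List.Relation.Binary.Subset.Propositional.Properties using (∷⁺ʳ; xs⊆x∷xs; All-resp-⊇)
open import Data.List.Relation.Unary.All as All using ([]; _∷_)
open import Data.List.Relation.Unary.AllPairs using ([]; _∷_)
open import Data.List.Relation.Unary.Any using (here; there)
open import Data.List.Relation.Unary.Any.Properties using (mapWith∈⁺; mapWith∈⁻)
open import Data.Nat using (ℕ; zero; suc; _+_; _≤_; _<_; z≤n; s≤s; _%_)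
import Data.Nat.Properties as ℕ
open import Data.Product using (_×_; _,_; proj₁; proj₂; ∃-syntax; Σ-syntax)
open import Data.Sum using (inj₁; inj₂)
open import Data.Unit using (tt)
open import Data.Vec using (_∷_; _++_; here; there)
open import Data.Vec.Properties using ([]=⇒lookup; lookup⇒[]=; lookup-splitAt; lookup-replicate)
open import Function using (_∘_; _⇔_; mk⇔; Equivalence)
open import Relation.Binary.Construct.Closure.ReflexiveTransitive using (ε; _◅_)
open import Relation.Binary.Definitions using (tri<; tri≈; tri>)
open import Relation.Binary.PropositionalEquality using (_≡_; _≢_; refl; sym; trans; cong; subst)
open import Relation.Nullary using (¬_; yes; no; contradiction)
open import Relation.Nullary.Decidable using (¬?; _×-dec_; decidable-stable)

-- Parities and mex.

n%2≢[1+n]%2 : ∀ n → n % 2 ≢ suc n % 2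
n%2≢[1+n]%2 zero          = λ ()
n%2≢[1+n]%2 (suc zero)    = λ ()
n%2≢[1+n]%2 (suc (suc n)) = n%2≢[1+n]%2 n

-- Together with `n%2≢[1+n]%2`, this makes `suc n % 2` the mex of the singleton of `n % 2`.
j<[1+n]%2⇒j≡n%2 : ∀ n {j} → j < suc n % 2 → j ≡ n % 2
j<[1+n]%2⇒j≡n%2 zero          {zero}  _         = refl
j<[1+n]%2⇒j≡n%2 zero          {suc _} (s≤s ())
j<[1+n]%2⇒j≡n%2 (suc zero)    ()
j<[1+n]%2⇒j≡n%2 (suc (suc n)) j<                = j<[1+n]%2⇒j≡n%2 n j<

isMex-unique : ∀ {A j k} → IsMex A j → IsMex A k → j ≡ k
isMex-unique {j = j} {k} (j∉ , below-j) (k∉ , below-k) with ℕ.<-cmp j k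
... | tri< j<k _ _ = contradiction (below-k j j<k) j∉
... | tri≈ _ j≡k _ = j≡k
... | tri> _ _ k<j = contradiction (below-j k k<j) k∉

module _ (Γ : Game) where
  open Game Γ

  -- Since a mex is unique, a nim-value can be certified by its two defining conditions without
  -- computing the list of option values.
  nimValue-≡ : ∀ p k →
    (∀ q → q IsOptionOf p → nimValue Γ q ≢ k) →
    (∀ j → j < k → ∃[ q ] q IsOptionOf p × nimValue Γ q ≡ j) →
    nimValue Γ p ≡ k
  nimValue-≡ p k excluded attained =
    trans (nimValue-mex Γ p) (isMex-unique (mex-isMex _) (k∉ , below))
    where
    k∉ : ¬ k ∈ˡ map (nimValue Γ) (options p)
    k∉ k∈ with ∈-map⁻ (nimValue Γ) k∈
    ... | q , q∈ , k≡ = excluded q q∈ (sym k≡)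

    below : ∀ j → j < k → j ∈ˡ map (nimValue Γ) (options p)
    below j j<k with attained j j<k
    ... | q , q∈ , refl = ∈-map⁺ (nimValue Γ) q∈

-- Finite subsets and their cardinalities.

∣p∪⁅x⁆∣≡1+∣p∣ : ∀ {n} (p : Subset n) {x} → x ∉ p → ∣ p ∪ ⁅ x ⁆ ∣ ≡ suc ∣ p ∣
∣p∪⁅x⁆∣≡1+∣p∣ (true  ∷ p) {zero}  x∉p = contradiction here x∉p
∣p∪⁅x⁆∣≡1+∣p∣ (false ∷ p) {zero}  x∉p = cong (suc ∘ ∣_∣) (∪-identityʳ p)
∣p∪⁅x⁆∣≡1+∣p∣ (true  ∷ p) {suc x} x∉p = cong suc (∣p∪⁅x⁆∣≡1+∣p∣ p (x∉p ∘ there))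
∣p∪⁅x⁆∣≡1+∣p∣ (false ∷ p) {suc x} x∉p = ∣p∪⁅x⁆∣≡1+∣p∣ p (x∉p ∘ there)

∣⊤++⊥∣≡m : ∀ m n → ∣ ⊤ {m} ++ ⊥ {n} ∣ ≡ m
∣⊤++⊥∣≡m zero    n = ∣⊥∣≡0 n
∣⊤++⊥∣≡m (suc m) n = cong suc (∣⊤++⊥∣≡m m n)

∣p∣<∣q∣⇒∃x∈q∖p : ∀ {n} {p q : Subset n} → ∣ p ∣ < ∣ q ∣ → ∃[ x ] x ∈ q × x ∉ p
∣p∣<∣q∣⇒∃x∈q∖p {p = p} {q} ∣p∣<∣q∣ =
  decidable-stable (any? λ x → (x ∈? q) ×-dec ¬? (x ∈? p)) λ ∄ →
    ℕ.<⇒≱ ∣p∣<∣q∣ (p⊆q⇒∣p∣≤∣q∣ λ {x} x∈q →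
      decidable-stable (x ∈? p) λ x∉p → ∄ (x , x∈q , x∉p))

∪⁅⁆-⊆ : ∀ {n} {p q : Subset n} {x} → p ⊆ q → x ∈ q → p ∪ ⁅ x ⁆ ⊆ q
∪⁅⁆-⊆ {p = p} {q} {x} p⊆q x∈q y∈ with x∈p∪q⁻ p ⁅ x ⁆ y∈
... | inj₁ y∈p = p⊆q y∈p
... | inj₂ y∈x with refl ← x∈⁅y⁆⇒x≡y x y∈x = x∈q

x∈p∪⁅x⁆ : ∀ {n} {p : Subset n} {x} → x ∈ p ∪ ⁅ x ⁆
x∈p∪⁅x⁆ {x = x} = x∈p∪q⁺ (inj₂ (x∈⁅x⁆ x))

-- Convex hulls, simplicial vertices and shortest paths.

module _ (G : Graph) where
  open Graph G

  hull-convex : ∀ P → IsConvex G (hull G P)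
  hull-convex P = proj₁ (proj₂ (convexHull G P))

  ⊆hull : ∀ P → P ⊆ hull G P
  ⊆hull P = proj₁ (proj₂ (proj₂ (convexHull G P)))

  hull-minimal : ∀ P C → IsConvex G C → P ⊆ C → hull G P ⊆ C
  hull-minimal P = proj₂ (proj₂ (proj₂ (convexHull G P)))

  -- The two edges are oriented as consecutive steps of a walk through `x`, ready to be replaced by
  -- a single edge.
  IsSimplicial : Vertex → Set
  IsSimplicial x = ∀ {y z} → y ~ x → x ~ z → y ≢ z → y ~ z

  start∈vertices : ∀ {u v} (w : Walk G u v) → u ∈ˡ vertices G w
  start∈vertices ε       = here refl
  start∈vertices (_ ◅ _) = here refl

  -- The predecessor and successor of `x` on the path are distinct neighbours of `x`, hence
  -- adjacent, so `x` can be cut out. The inclusion of vertex lists carries the induction: it keeps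
  -- the extended walk a path.
  bypass-simplicial : ∀ {x u v} → IsSimplicial x → u ≢ x → v ≢ x →
    (w : Walk G u v) → IsPath G w → x ∈ˡ vertices G w →
    Σ[ w′ ∈ Walk G u v ] IsPath G w′ × edges G w′ < edges G w × vertices G w′ ⊆ˡ vertices G w
  bypass-simplicial s u≢x v≢x ε       _ (here refl) = contradiction refl u≢x
  bypass-simplicial s u≢x v≢x (e ◅ w) _ (here refl) = contradiction refl u≢x
  bypass-simplicial {x} {u} s u≢x v≢x (_◅_ {j = y} e w) (u∉w ∷ p) (there x∈w) with y ≟ x
  bypass-simplicial {x} {u} s u≢x v≢x (_◅_ {j = y} e w) (u∉w ∷ p) (there x∈w) | no y≢x
    with w′ , p′ , shorter , w′⊆w ← bypass-simplicial s y≢x v≢x w p x∈w =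
    e ◅ w′ , All-resp-⊇ w′⊆w u∉w ∷ p′ , s≤s shorter , ∷⁺ʳ u w′⊆w
  bypass-simplicial s u≢x v≢x (e ◅ ε)      _ (there _) | yes refl = contradiction refl v≢x
  bypass-simplicial {x} {u} s u≢x v≢x (e ◅ f ◅ w) ((_ ∷ u∉w) ∷ _ ∷ p) (there _) | yes refl =
    -- Here `w` starts at the successor of `x`; as `u` does not occur on `w`, it differs from that
    -- successor.
    s e f (All.lookup u∉w (start∈vertices w)) ◅ w , u∉w ∷ p , ℕ.≤-refl , ∷⁺ʳ u (xs⊆x∷xs _ x)

  -- A shortest path between two other vertices avoids `x`, since bypassing `x` would give a shorter
  -- path.
  ∁-simplicial-convex : ∀ {x} → IsSimplicial x → IsConvex G (∁ ⁅ x ⁆)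
  ∁-simplicial-convex {x} s u v y u∈ v∈ (w , (p , shortest) , y∈w) =
    x∉p⇒x∈∁p λ y∈x → x∉w (subst (_∈ˡ vertices G w) (x∈⁅y⁆⇒x≡y x y∈x) y∈w)
    where
    ≢x : ∀ {z} → z ∈ ∁ ⁅ x ⁆ → z ≢ x
    ≢x z∈ refl = x∈∁p⇒x∉p z∈ (x∈⁅x⁆ x)

    x∉w : ¬ x ∈ˡ vertices G w
    x∉w x∈w with w′ , p′ , shorter , _ ← bypass-simplicial s (≢x u∈) (≢x v∈) w p x∈w =
      ℕ.<⇒≱ shorter (shortest w′ p′)

  -- If `x` were in `P`, then `∁ P` would lie in the convex set `∁ ⁅ x ⁆`, and its hull would miss
  -- `x`.
  complementGenerates-∌simplicial : ∀ {P x} → IsSimplicial x → ComplementGenerates G P → x ∉ P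
  complementGenerates-∌simplicial {P} {x} s generates x∈P =
    x∈∁p⇒x∉p (hull-minimal (∁ P) (∁ ⁅ x ⁆) (∁-simplicial-convex s) ∁P⊆ (subst (x ∈_) (sym generates) ∈⊤))
      (x∈⁅x⁆ x)
    where
    ∁P⊆ : ∁ P ⊆ ∁ ⁅ x ⁆
    ∁P⊆ y∈∁P = x∉p⇒x∈∁p λ y∈x →
      x∈∁p⇒x∉p y∈∁P (subst (_∈ P) (sym (x∈⁅y⁆⇒x≡y x y∈x)) x∈P)

  midpoint-onShortestPath : ∀ {a b x} → a ≢ b → ¬ a ~ b → a ~ x → x ~ b → OnShortestPath G a b x
  midpoint-onShortestPath {a} {b} {x} a≢b a≁b a~x x~b =
    a~x ◅ x~b ◅ ε , (path , shortest) , there (here refl)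
    where
    path : IsPath G (a~x ◅ x~b ◅ ε)
    path = ((λ a≡x → ~-irr a≡x a~x) ∷ a≢b ∷ []) ∷ ((λ x≡b → ~-irr x≡b x~b) ∷ []) ∷ [] ∷ []

    shortest : ∀ w → IsPath G w → 2 ≤ edges G w
    shortest ε           _ = contradiction refl a≢b
    shortest (a~b ◅ ε)   _ = contradiction a~b a≁b
    shortest (_ ◅ _ ◅ _) _ = s≤s (s≤s z≤n)

  -- Options of the two games.

  ∈-extensions⁺ : ∀ {P v} → v ∉ P → P ∪ ⁅ v ⁆ ∈ˡ extensions G P
  ∈-extensions⁺ {P} {v} v∉P =
    ∈-map⁺ _ (∈-filter⁺ (λ v → ¬? (v ∈? P)) (∈-allFin v) v∉P)

  ∈-extensions⁻ : ∀ {P Q} → Q ∈ˡ extensions G P → ∃[ v ] v ∉ P × Q ≡ P ∪ ⁅ v ⁆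
  ∈-extensions⁻ {P} Q∈ with v , v∈ , Q≡ ← ∈-map⁻ _ Q∈ =
    v , proj₂ (∈-filter⁻ (λ v → ¬? (v ∈? P)) {xs = allFin order} v∈) , Q≡

  -- The proof component is existential because a listed position carries the proof found by
  -- `complementGenerates?`, not the one supplied.
  ∈-toDNT⁺ : ∀ {Q} Qs → ComplementGenerates G Q → Q ∈ˡ Qs →
             ∃[ g ] (Q , g) ∈ˡ mapMaybe (toDNTPosition G) Qs
  ∈-toDNT⁺ (Q ∷ Qs) g Q∈ with complementGenerates? G Q
  ∈-toDNT⁺ (Q ∷ Qs) g (here refl) | yes g′ = g′ , here refl
  ∈-toDNT⁺ (Q ∷ Qs) g (here refl) | no ¬g  = contradiction g ¬g
  ∈-toDNT⁺ (Q ∷ Qs) g (there Q∈)  | yes _ with h , ∈ ← ∈-toDNT⁺ Qs g Q∈ = h , there ∈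
  ∈-toDNT⁺ (Q ∷ Qs) g (there Q∈)  | no _  = ∈-toDNT⁺ Qs g Q∈

  ∈-toDNT⁻ : ∀ {q} Qs → q ∈ˡ mapMaybe (toDNTPosition G) Qs → proj₁ q ∈ˡ Qs
  ∈-toDNT⁻ (Q ∷ Qs) q∈ with complementGenerates? G Q
  ∈-toDNT⁻ (Q ∷ Qs) (here refl) | yes _ = here refl
  ∈-toDNT⁻ (Q ∷ Qs) (there q∈)  | yes _ = there (∈-toDNT⁻ Qs q∈)
  ∈-toDNT⁻ (Q ∷ Qs) q∈          | no _  = there (∈-toDNT⁻ Qs q∈)

  terMoves-generating : ∀ {P} → ComplementGenerates G P → terMoves G P ≡ extensions G P
  terMoves-generating {P} g with complementGenerates? G P
  ... | yes _ = refl
  ... | no ¬g = contradiction g ¬g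

  terMoves-terminal : ∀ {P Q} → ¬ ComplementGenerates G P → ¬ Q ∈ˡ terMoves G P
  terMoves-terminal {P} ¬g with complementGenerates? G P
  ... | yes g = contradiction g ¬g
  ... | no  _ = λ ()

  nimTER-terminal : ∀ {P} r → ¬ ComplementGenerates G P → nimValue (TER G) (P , r) ≡ 0
  nimTER-terminal {P} r ¬g = nimValue-≡ (TER G) (P , r) 0
    (λ q q∈ → contradiction (proj₁ (proj₂ (mapWith∈⁻ (terMoves G P) _ q∈))) (terMoves-terminal ¬g))
    (λ _ ())

  -- Nim-values when the generating complements are those of the subsets of a fixed set.

  module _ {A : Subset order} (generates⇔⊆A : ∀ {P} → ComplementGenerates G P ⇔ P ⊆ A) where
    private
      ⊆A : ∀ {P} → ComplementGenerates G P → P ⊆ A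
      ⊆A = Equivalence.to generates⇔⊆A

      generates : ∀ {P} → P ⊆ A → ComplementGenerates G P
      generates = Equivalence.from generates⇔⊆A

      -- Here `d` counts the vertices of `A` still to be taken; the nim-value proofs recurse on it.
      record Free (d : ℕ) (P : Subset order) : Set where
        constructor free
        field
          P⊆A     : P ⊆ A
          ∣P∣+d≡∣A∣ : ∣ P ∣ + d ≡ ∣ A ∣

      -- A vertex of `A` outside `P` would make `P` a proper subset of `A`, although the
      -- cardinalities agree.
      no-move : ∀ {P v} → Free 0 P → v ∉ P → v ∉ A
      no-move {P} {v} (free P⊆A eq) v∉P v∈A = ℕ.<-irrefl (trans (sym (ℕ.+-identityʳ _)) eq)
        (p⊂q⇒∣p∣<∣q∣ ((λ {x} → P⊆A {x}) , v , v∈A , v∉P))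

      move-free : ∀ {d P v} → Free (suc d) P → v ∉ P → v ∈ A → Free d (P ∪ ⁅ v ⁆)
      move-free {d} {P} (free P⊆A eq) v∉P v∈A =
        free (∪⁅⁆-⊆ P⊆A v∈A)
          (trans (cong (_+ d) (∣p∪⁅x⁆∣≡1+∣p∣ P v∉P)) (trans (sym (ℕ.+-suc ∣ P ∣ d)) eq))

      ∃-move : ∀ {d P} → Free (suc d) P → ∃[ v ] v ∈ A × v ∉ P
      ∃-move {d} {P} (free _ eq) = ∣p∣<∣q∣⇒∃x∈q∖p
        (subst (∣ P ∣ <_) eq (ℕ.m<m+n ∣ P ∣ (s≤s z≤n)))

    -- Every option takes a vertex of `A` and has one vertex fewer left, so all options share one
    -- parity as value and the mex is the other parity. With nothing left there are no options.
    nimDNT-free : ∀ d {P} g → Free d P → nimValue (DNT G) (P , g) ≡ d % 2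
    nimDNT-free d {P} g f = nimValue-≡ (DNT G) (P , g) (d % 2) (excluded d f) (attained d f)
      where
      excluded : ∀ d → Free d P → ∀ q → q ∈ˡ Game.options (DNT G) (P , g) → nimValue (DNT G) q ≢ d % 2
      excluded d f (Q , h) q∈ with ∈-extensions⁻ (∈-toDNT⁻ (extensions G P) q∈)
      excluded zero    f (Q , h) q∈ | v , v∉P , refl = contradiction (⊆A h x∈p∪⁅x⁆) (no-move f v∉P)
      excluded (suc d) f (Q , h) q∈ | v , v∉P , refl =
        n%2≢[1+n]%2 d ∘ trans (sym (nimDNT-free d h (move-free f v∉P (⊆A h x∈p∪⁅x⁆))))

      attained : ∀ d → Free d P → ∀ j → j < d % 2 →
                 ∃[ q ] q ∈ˡ Game.options (DNT G) (P , g) × nimValue (DNT G) q ≡ j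
      -- For `zero` the bound reads `j < 0`, so only successors occur.
      attained (suc d) f j j< with v , v∈A , v∉P ← ∃-move f
        with h , q∈ ← ∈-toDNT⁺ (extensions G P) (generates (Free.P⊆A (move-free f v∉P v∈A)))
                              (∈-extensions⁺ v∉P) =
        (P ∪ ⁅ v ⁆ , h) , q∈ ,
        trans (nimDNT-free d h (move-free f v∉P v∈A)) (sym (j<[1+n]%2⇒j≡n%2 d j<))

    -- Leaving `A` ends the game with value 0, and `i` guarantees such an option. For `suc d`,
    -- staying in `A` gives `1 + d % 2`, so the option values are {0, 1} or {0, 2}, with mex 2 or 1.
    -- For `zero` the only option value is 0, with mex 1.
    nimTER-free : ∀ {i} → i ∉ A → ∀ d {P} r → Free d P → nimValue (TER G) (P , r) ≡ 1 + d % 2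
    nimTER-free {i} i∉A d {P} r f = nimValue-≡ (TER G) (P , r) (1 + d % 2) excluded (attained d f)
      where
      terMoves≡ : terMoves G P ≡ extensions G P
      terMoves≡ = terMoves-generating (generates (Free.P⊆A f))

      nim-leaving : ∀ {v} r → v ∉ A → nimValue (TER G) (P ∪ ⁅ v ⁆ , r) ≡ 0
      nim-leaving r v∉A = nimTER-terminal r λ g → v∉A (⊆A g x∈p∪⁅x⁆)

      nim-staying : ∀ d {v} r → Free d P → v ∉ P → v ∈ A → nimValue (TER G) (P ∪ ⁅ v ⁆ , r) ≢ 1 + d % 2
      nim-staying zero    r f v∉P v∈A = contradiction v∈A (no-move f v∉P)
      nim-staying (suc d) r f v∉P v∈A eq = n%2≢[1+n]%2 d
        (ℕ.suc-injective (trans (sym (nimTER-free i∉A d r (move-free f v∉P v∈A))) eq))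

      excluded : ∀ q → q ∈ˡ Game.options (TER G) (P , r) → nimValue (TER G) q ≢ 1 + d % 2
      excluded q q∈ with Q , Q∈ , refl ← mapWith∈⁻ (terMoves G P) _ q∈
        with v , v∉P , refl ← ∈-extensions⁻ (subst (Q ∈ˡ_) terMoves≡ Q∈)
        with v ∈? A
      ... | yes v∈A = nim-staying d _ f v∉P v∈A
      ... | no  v∉A = λ eq → ℕ.0≢1+n (trans (sym (nim-leaving _ v∉A)) eq)

      option : ∀ v → v ∉ P → ∃[ r′ ] (P ∪ ⁅ v ⁆ , r′) ∈ˡ Game.options (TER G) (P , r)
      option v v∉P =
        move r Q∈ , mapWith∈⁺ (λ {Q} Q∈ → Q , move r Q∈) (P ∪ ⁅ v ⁆ , Q∈ , refl)
        where
        Q∈ : P ∪ ⁅ v ⁆ ∈ˡ terMoves G P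
        Q∈ = subst (P ∪ ⁅ v ⁆ ∈ˡ_) (sym terMoves≡) (∈-extensions⁺ v∉P)

      attained : ∀ d → Free d P → ∀ j → j < 1 + d % 2 →
                 ∃[ q ] q ∈ˡ Game.options (TER G) (P , r) × nimValue (TER G) q ≡ j
      -- The value 0 is attained by adding `i` to `P`.
      attained d f zero _ with r′ , q∈ ← option i (λ i∈P → i∉A (Free.P⊆A f i∈P)) =
        _ , q∈ , nim-leaving r′ i∉A
      attained zero    f (suc j) (s≤s ())
      attained (suc d) f (suc j) (s≤s j<) with v , v∈A , v∉P ← ∃-move f
        with r′ , q∈ ← option v v∉P =
        _ , q∈ , trans (nimTER-free i∉A d r′ (move-free f v∉P v∈A)) (cong suc (sym (j<[1+n]%2⇒j≡n%2 d j<)))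

    private
      start-free : Free ∣ A ∣ ⊥
      start-free = free ⊥⊆ (cong (_+ ∣ A ∣) (∣⊥∣≡0 order))

    nim-DNT : nim (DNT G) ≡ ∣ A ∣ % 2
    nim-DNT = nimDNT-free ∣ A ∣ (proj₂ (Game.start (DNT G))) start-free

    nim-TER : ∀ {i} → i ∉ A → nim (TER G) ≡ 1 + ∣ A ∣ % 2
    nim-TER i∉A = nimTER-free i∉A ∣ A ∣ initial start-free

-- The complete split graph.

module _ (m n : ℕ) where
  private
    G = join (K m) (complement (K n))
  open Graph G

  -- `join` numbers the vertices of `K m` first, so they form the initial block.
  clique : Subset (m + n)
  clique = ⊤ {m} ++ ⊥ {n}

  ∈clique⁻ : ∀ {u} → u ∈ clique → ∃[ i ] splitAt m u ≡ inj₁ i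
  ∈clique⁻ {u} u∈ with splitAt m u | lookup-splitAt m (⊤ {m}) (⊥ {n}) u
  ... | inj₁ i | _  = i , refl
  ... | inj₂ j | eq = contradiction
    (trans (sym ([]=⇒lookup u∈)) (trans eq (lookup-replicate j false))) λ ()

  ∉clique⁻ : ∀ {u} → u ∉ clique → ∃[ j ] splitAt m u ≡ inj₂ j
  ∉clique⁻ {u} u∉ with splitAt m u | lookup-splitAt m (⊤ {m}) (⊥ {n}) u
  ... | inj₁ i | eq = contradiction (lookup⇒[]= u _ (trans eq (lookup-replicate i true))) u∉
  ... | inj₂ j | _  = j , refl

  ↑ʳ∉clique : ∀ j → m ↑ʳ j ∉ clique
  ↑ʳ∉clique j j∈ with i , eq ← ∈clique⁻ j∈ =
    contradiction (trans (sym eq) (splitAt-↑ʳ m n j)) λ ()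

  clique-adjacent : ∀ {u v} → u ∈ clique → u ≢ v → u ~ v
  clique-adjacent {u} {v} u∈ u≢v with i , eq ← ∈clique⁻ u∈ rewrite eq with splitAt m v in eq′
  -- Adjacency within `K m` is inequality of indices, and equal indices would come from equal
  -- vertices.
  ... | inj₁ j = λ { refl → u≢v (trans (sym (splitAt⁻¹-↑ˡ eq)) (splitAt⁻¹-↑ˡ eq′)) }
  ... | inj₂ _ = tt

  nonclique-independent : ∀ {u v} → u ∉ clique → v ∉ clique → ¬ u ~ v
  nonclique-independent u∉ v∉ u~v
    with i , eq ← ∉clique⁻ u∉ | j , eq′ ← ∉clique⁻ v∉ rewrite eq | eq′
    -- An edge of the complement of `K n` would need indices that are distinct and yet not adjacent
    -- in `K n`, that is, not distinct.
    with i≢j , ¬i≢j ← u~v = ¬i≢j i≢j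

  -- All neighbours of `x` lie in the clique, and a clique vertex is adjacent to every other vertex.
  nonclique-simplicial : ∀ {x} → x ∉ clique → IsSimplicial G x
  nonclique-simplicial x∉ {y} y~x _ = clique-adjacent
    (decidable-stable (y ∈? clique) λ y∉ → nonclique-independent y∉ x∉ y~x)

  complementGenerates⇒⊆clique : ∀ {P} → ComplementGenerates G P → P ⊆ clique
  complementGenerates⇒⊆clique g {x} x∈P = decidable-stable (x ∈? clique) λ x∉ →
    complementGenerates-∌simplicial G (nonclique-simplicial x∉) g x∈P

  ⊆clique⇒complementGenerates : ∀ {a b P} → a ∉ clique → b ∉ clique → a ≢ b →
    P ⊆ clique → ComplementGenerates G P
  ⊆clique⇒complementGenerates {a} {b} {P} a∉ b∉ a≢b P⊆ = ⊆-antisym ⊆⊤ λ {x} _ → all x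
    where
    nonclique∈hull : ∀ {x} → x ∉ clique → x ∈ hull G (∁ P)
    nonclique∈hull x∉ = ⊆hull G (∁ P) (x∉p⇒x∈∁p (x∉ ∘ P⊆))

    all : ∀ x → x ∈ hull G (∁ P)
    all x with x ∈? clique
    ... | no  x∉ = nonclique∈hull x∉
    -- Both `a` and `b` survive in `∁ P`, and `x` is the midpoint of a shortest path between them.
    ... | yes x∈ = hull-convex G (∁ P) a b x (nonclique∈hull a∉) (nonclique∈hull b∉)
      (midpoint-onShortestPath G a≢b (nonclique-independent a∉ b∉)
        (~-sym {x} {a} (clique-adjacent x∈ λ { refl → a∉ x∈ }))
        (clique-adjacent x∈ λ { refl → b∉ x∈ }))

proposition4p6 : ∀ (m n : ℕ) → 2 ≤ n → let G = join (K m) (complement (K n)) in (nim (DNT G) ≡ pty (+ m)) × (nim (TER G) ≡ 1 + pty (+ m))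
proposition4p6 m n@(suc (suc _)) (s≤s (s≤s z≤n)) =
  -- `pty (+ m)` reduces to `m % 2`, so only the size of the clique has to be rewritten.
  trans (nim-DNT G generates⇔) (cong (_% 2) (∣⊤++⊥∣≡m m n)) ,
  trans (nim-TER G generates⇔ (↑ʳ∉clique m n zero)) (cong (λ k → 1 + k % 2) (∣⊤++⊥∣≡m m n))
  where
  G = join (K m) (complement (K n))

  generates⇔ : ∀ {P} → ComplementGenerates G P ⇔ P ⊆ clique m n
  generates⇔ = mk⇔ (λ g {x} → complementGenerates⇒⊆clique m n g {x})
    -- The bound on `n` enters here: it supplies two distinct vertices outside the clique.
    (⊆clique⇒complementGenerates m n (↑ʳ∉clique m n zero) (↑ʳ∉clique m n (suc zero))
      λ eq → contradiction (↑ʳ-injective m zero (suc zero) eq) λ ())
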